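{- For every $\varepsilon>0$ there exists a simple $2$-connected bipartite cubic graph $G$ such that every traveling salesman tour of $G$ has length at least $(1.2-\varepsilon)\,|V(G)|$.
   Context: A traveling salesman tour (TSP tour) of a connected graph $G$ is a closed walk in $G$ that visits every vertex of $G$; its length is the number of edges of the walk counted with multiplicity. -}

module Defs where

open import Data.Nat using (ℕ; zero; suc; _+_; _≥_)
open import Data.Fin using (Fin)
open import Data.Bool using (Bool; true; false; if_then_else_)
open import Data.List using (List; map; allFin)
open import Data.Nat.ListAction using (sum)
open import Data.Product using (Σ; ∃; _×_)
open import Data.Sum using (_⊎_)
open import Relation.Binary.PropositionalEquality using (_≡_; _≢_)
open import Relation.Nullary using (¬_)

record SimpleGraph : Set where
  field
    n     : ℕ
    Adj   : Fin n → Fin n → Bool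
    sym   : ∀ u v → Adj u v ≡ Adj v u
    irrefl : ∀ v → Adj v v ≡ false

open SimpleGraph public

V : SimpleGraph → Set
V G = Fin (n G)

order : SimpleGraph → ℕ
order G = n G

degree : (G : SimpleGraph) → V G → ℕ
degree G v = sum (map (λ w → if Adj G v w then 1 else 0) (allFin (n G)))

Cubic : SimpleGraph → Set
Cubic G = ∀ v → degree G v ≡ 3

Bipartite : SimpleGraph → Set
Bipartite G = Σ (V G → Bool) λ c → ∀ u v → Adj G u v ≡ true → c u ≢ c v

data Walk (G : SimpleGraph) : V G → V G → Set where
  here : ∀ {v} → Walk G v v
  step : ∀ {u w v} → Adj G u w ≡ true → Walk G w v → Walk G u v

len : ∀ {G u v} → Walk G u v → ℕ
len here = 0
len (step _ p) = suc (len p)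

data Visits {G : SimpleGraph} (x : V G) : ∀ {u v} → Walk G u v → Set where
  at-here : Visits x (here {v = x})
  at-step : ∀ {w v} (a : Adj G x w ≡ true) (p : Walk G w v) → Visits x (step a p)
  later   : ∀ {u w v} (a : Adj G u w ≡ true) {p : Walk G w v} → Visits x p → Visits x (step a p)

Connected : SimpleGraph → Set
Connected G = ∀ (x y : V G) → Walk G x y

ConnectedWithout : (G : SimpleGraph) → V G → Set
ConnectedWithout G v = ∀ (x y : V G) → x ≢ v → y ≢ v →
  Σ (Walk G x y) λ p → ¬ Visits v p

TwoConnected : SimpleGraph → Set
TwoConnected G = (n G ≥ 3) × Connected G × (∀ v → ConnectedWithout G v)

record TSPTour (G : SimpleGraph) : Set where
  field
    start : V G
    walk  : Walk G start start
    covers : ∀ x → Visits x walk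

{-# OPTIONS --safe #-}

-- A tour uses every edge cut an even, positive number of times, and nothing else about it is
-- needed. For a piece of the graph attached by two edges of multiplicities p and q, let F be
-- the number of steps on the piece and on these two edges. K₃,₃ minus an edge satisfies
-- F ≥ B + 1 if p, q are odd and F ≥ B + 2 if they are even, with B = 6. Putting two such pieces
-- in parallel between new vertices b, c and then attaching b, c to two new adjacent vertices
-- preserves this property: B becomes 2B + 6, while the number s of vertices becomes 2s + 4.
-- Hence 5B = 6s − 6 throughout. Finally two copies in parallel between adjacent vertices give a
-- cubic graph on n = 2s + 2 vertices all of whose tours have length at least 2(B + 1), that is
-- (6n − 14) / 5.
module Submission where

open import Defs

module _ where
  open import Data.Nat as ℕ using (ℕ; zero; suc; _+_; _*_; parity; _≤_; z≤n; s≤s)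
  open import Data.Nat.Properties
  open import Data.Nat.Tactic.RingSolver using (solve; solve-∀)
  open import Data.Parity.Base as ℙ using (0ℙ; 1ℙ)
  open import Data.Parity.Properties using () renaming (+-homo-+ to parity-+)
  open import Data.Fin using (Fin; zero; suc; splitAt; _↑ˡ_; _↑ʳ_)
  open import Data.Fin.Properties using (join-splitAt; splitAt-↑ˡ; splitAt-↑ʳ)
    renaming (_≟_ to _≟ᶠ_)
  open import Data.Bool using (Bool; true; false; not; _xor_; if_then_else_)
  open import Data.Bool.Properties using (xor-same; xor-comm; not-involutive; not-¬; ¬-not)
  open import Data.Product using (Σ; ∃; _×_; _,_; proj₁; proj₂)
  open import Data.Sum as Sum using (_⊎_; inj₁; inj₂; [_,_]′)
  open import Data.Sum.Properties using (inj₁-injective; inj₂-injective)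
  open import Data.Unit using (⊤; tt)
  open import Data.List using ([]; _∷_; map; allFin; tabulate)
  open import Data.List.Properties using (map-tabulate)
  import Data.Nat.ListAction as List
  open import Algebra.Properties.CommutativeMonoid.Sum +-0-commutativeMonoid
    using (sum; sum-cong-≗; sum-replicate-zero; ∑-distrib-+)
  open import Relation.Binary.Construct.Closure.ReflexiveTransitive using (Star; ε; _◅_; _◅◅_; gmap; reverse)
  open import Relation.Binary.PropositionalEquality renaming (sym to ≡-sym)
  open import Relation.Nullary using (¬_; does; yes; contradiction)
  open import Relation.Nullary.Decidable using (dec-true)
  open import Function using (_∘_; const; id)

  -- Finite types as nested sums, and summation over them.

  ⟦_⟧ : Bool → ℕ
  ⟦ b ⟧ = if b then 1 else 0

  infixr 5 _⊕_

  -- Vertex and edge sets are built as nested disjoint unions, so that labellings of a gadget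
  -- restrict to its parts by composition with the injections and sums over it split by computation.
  data Code : Set where
    leaf : ℕ → Code
    _⊕_  : Code → Code → Code

  El : Code → Set
  El (leaf n) = Fin n
  El (a ⊕ b)  = El a ⊎ El b

  size : Code → ℕ
  size (leaf n) = n
  size (a ⊕ b)  = size a + size b

  eq : ∀ c → El c → El c → Bool
  eq (leaf n) i        j        = does (i ≟ᶠ j)
  eq (a ⊕ b)  (inj₁ x) (inj₁ y) = eq a x y
  eq (a ⊕ b)  (inj₂ x) (inj₂ y) = eq b x y
  eq (a ⊕ b)  (inj₁ _) (inj₂ _) = false
  eq (a ⊕ b)  (inj₂ _) (inj₁ _) = false

  eq-refl : ∀ c x → eq c x x ≡ true
  eq-refl (leaf n) i        = dec-true (i ≟ᶠ i) refl
  eq-refl (a ⊕ b)  (inj₁ x) = eq-refl a x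
  eq-refl (a ⊕ b)  (inj₂ y) = eq-refl b y

  eq-sound : ∀ c x y → eq c x y ≡ true → x ≡ y
  eq-sound (leaf n) i        j        p with yes i≡j ← i ≟ᶠ j = i≡j
  eq-sound (a ⊕ b)  (inj₁ x) (inj₁ y) p = cong inj₁ (eq-sound a x y p)
  eq-sound (a ⊕ b)  (inj₂ x) (inj₂ y) p = cong inj₂ (eq-sound b x y p)

  ∑ : ∀ c → (El c → ℕ) → ℕ
  ∑ (leaf n) f = sum f
  ∑ (a ⊕ b)  f = ∑ a (f ∘ inj₁) + ∑ b (f ∘ inj₂)

  ∑-cong : ∀ c {f g} → f ≗ g → ∑ c f ≡ ∑ c g
  ∑-cong (leaf n) f≗g = sum-cong-≗ f≗g
  ∑-cong (a ⊕ b)  f≗g = cong₂ _+_ (∑-cong a (f≗g ∘ inj₁)) (∑-cong b (f≗g ∘ inj₂))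

  ∑-zero : ∀ c → ∑ c (const 0) ≡ 0
  ∑-zero (leaf n) = sum-replicate-zero n
  ∑-zero (a ⊕ b)  = cong₂ _+_ (∑-zero a) (∑-zero b)

  +-interchange : ∀ a b c d → (a + b) + (c + d) ≡ (a + c) + (b + d)
  +-interchange = solve-∀

  ∑-+ : ∀ c f g → ∑ c (λ x → f x + g x) ≡ ∑ c f + ∑ c g
  ∑-+ (leaf n) f g = ∑-distrib-+ f g
  ∑-+ (a ⊕ b)  f g = trans
    (cong₂ _+_ (∑-+ a (f ∘ inj₁) (g ∘ inj₁)) (∑-+ b (f ∘ inj₂) (g ∘ inj₂)))
    (+-interchange (∑ a (f ∘ inj₁)) (∑ a (g ∘ inj₁)) (∑ b (f ∘ inj₂)) (∑ b (g ∘ inj₂)))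

  -- `eq c x` acts as a Kronecker delta. This extracts the contribution of one edge when a walk is
  -- extended by one step.
  ∑-select : ∀ c x (φ : El c → ℕ) → ∑ c (λ y → ⟦ eq c x y ⟧ * φ y) ≡ φ x
  ∑-select (leaf (suc n)) zero φ
    rewrite sum-replicate-zero n = trans (+-identityʳ _) (*-identityˡ _)
  ∑-select (leaf (suc n)) (suc i) φ = ∑-select (leaf n) i (φ ∘ suc)
  ∑-select (a ⊕ b) (inj₁ x) φ
    rewrite ∑-select a x (φ ∘ inj₁) | ∑-zero b = +-identityʳ _
  ∑-select (a ⊕ b) (inj₂ y) φ
    rewrite ∑-zero a | ∑-select b y (φ ∘ inj₂) = refl

  ∑-eq : ∀ c x → ∑ c (λ y → ⟦ eq c x y ⟧) ≡ 1
  ∑-eq c x = trans (∑-cong c (λ y → ≡-sym (*-identityʳ _))) (∑-select c x (const 1))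

  -- `SimpleGraph` has vertices in `Fin n`; `to` and `from` are inverse enumerations through which
  -- the structured vertex types become graphs of that form.
  to : ∀ c → Fin (size c) → El c
  to (leaf n) i = i
  to (a ⊕ b)  i = Sum.map (to a) (to b) (splitAt (size a) i)

  from : ∀ c → El c → Fin (size c)
  from (leaf n) i        = i
  from (a ⊕ b)  (inj₁ x) = from a x ↑ˡ size b
  from (a ⊕ b)  (inj₂ y) = size a ↑ʳ from b y

  to-from : ∀ c x → to c (from c x) ≡ x
  to-from (leaf n) i        = refl
  to-from (a ⊕ b)  (inj₁ x)
    rewrite splitAt-↑ˡ (size a) (from a x) (size b) = cong inj₁ (to-from a x)
  to-from (a ⊕ b)  (inj₂ y)
    rewrite splitAt-↑ʳ (size a) (size b) (from b y) = cong inj₂ (to-from b y)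

  from-to : ∀ c i → from c (to c i) ≡ i
  from-to (leaf n) i = refl
  from-to (a ⊕ b)  i with splitAt (size a) i | join-splitAt (size a) (size b) i
  ... | inj₁ j | p = trans (cong (_↑ˡ size b) (from-to a j)) p
  ... | inj₂ k | p = trans (cong (size a ↑ʳ_) (from-to b k)) p

  sum-split : ∀ m n (f : Fin (m + n) → ℕ) → sum f ≡ sum (f ∘ (_↑ˡ n)) + sum (f ∘ (m ↑ʳ_))
  sum-split zero    n f = refl
  sum-split (suc m) n f = trans (cong (f zero +_) (sum-split m n (f ∘ suc))) (≡-sym (+-assoc (f zero) _ _))

  sum-to : ∀ c (f : El c → ℕ) → sum (f ∘ to c) ≡ ∑ c f
  sum-to (leaf n) f = refl
  sum-to (a ⊕ b)  f = trans (sum-split (size a) (size b) (f ∘ to (a ⊕ b))) (cong₂ _+_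
    (trans (sum-cong-≗ λ i → cong (f ∘ Sum.map (to a) (to b)) (splitAt-↑ˡ (size a) i (size b)))
           (sum-to a (f ∘ inj₁)))
    (trans (sum-cong-≗ λ i → cong (f ∘ Sum.map (to a) (to b)) (splitAt-↑ʳ (size a) (size b) i))
           (sum-to b (f ∘ inj₂))))

  sum-tabulate : ∀ n (f : Fin n → ℕ) → List.sum (tabulate f) ≡ sum f
  sum-tabulate zero    f = refl
  sum-tabulate (suc n) f = cong (f zero +_) (sum-tabulate n (f ∘ suc))

  sum-allFin : ∀ c (f : El c → ℕ) → List.sum (map (f ∘ to c) (allFin (size c))) ≡ ∑ c f
  sum-allFin c f = trans (cong List.sum (map-tabulate id (f ∘ to c)))
    (trans (sum-tabulate (size c) (f ∘ to c)) (sum-to c f))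

  -- Gadgets and their adjacency.

  -- Graphs with two ports, each of degree 2 and meant to receive one external half-edge:
  -- K₃,₃ minus an edge; a gadget with its ports joined to two new adjacent vertices; two
  -- gadgets in parallel between two new non-adjacent vertices. New vertices become the ports.
  data Gadget : Set where
    k33    : Gadget
    bridge : Gadget → Gadget
    par    : Gadget → Gadget → Gadget

  vertices : Gadget → Code
  vertices k33        = leaf 3 ⊕ leaf 3
  vertices (bridge g) = leaf 2 ⊕ vertices g
  vertices (par g h)  = leaf 2 ⊕ (vertices g ⊕ vertices h)

  Vertex : Gadget → Set
  Vertex g = El (vertices g)

  -- Edges of a gadget, without and with the two half-edges at the ports (leaf 2 of outer).
  inner outer : Gadget → Code
  inner k33        = leaf 2 ⊕ leaf 2 ⊕ (leaf 2 ⊕ leaf 2)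
  inner (bridge g) = leaf 1 ⊕ outer g
  inner (par g h)  = outer g ⊕ outer h
  outer g = leaf 2 ⊕ inner g

  port : ∀ g → Fin 2 → Vertex g
  port k33        zero       = inj₁ zero
  port k33        (suc zero) = inj₂ zero
  port (bridge g) i          = inj₁ i
  port (par g h)  i          = inj₁ i

  adj-k33 : Fin 3 → Fin 3 → Bool
  adj-k33 zero zero = false
  adj-k33 _    _    = true

  adj : ∀ g → Vertex g → Vertex g → Bool
  adj k33 (inj₁ i) (inj₂ j) = adj-k33 i j
  adj k33 (inj₂ j) (inj₁ i) = adj-k33 i j
  adj k33 (inj₁ _) (inj₁ _) = false
  adj k33 (inj₂ _) (inj₂ _) = false
  adj (bridge g) (inj₁ i) (inj₁ j) = not (eq (leaf 2) i j)
  adj (bridge g) (inj₁ i) (inj₂ w) = eq (vertices g) (port g i) w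
  adj (bridge g) (inj₂ u) (inj₁ i) = eq (vertices g) (port g i) u
  adj (bridge g) (inj₂ u) (inj₂ w) = adj g u w
  adj (par g h) (inj₁ _) (inj₁ _) = false
  adj (par g h) (inj₁ i) (inj₂ (inj₁ w)) = eq (vertices g) (port g i) w
  adj (par g h) (inj₁ i) (inj₂ (inj₂ w)) = eq (vertices h) (port h i) w
  adj (par g h) (inj₂ (inj₁ u)) (inj₁ i) = eq (vertices g) (port g i) u
  adj (par g h) (inj₂ (inj₂ u)) (inj₁ i) = eq (vertices h) (port h i) u
  adj (par g h) (inj₂ (inj₁ u)) (inj₂ (inj₁ w)) = adj g u w
  adj (par g h) (inj₂ (inj₂ u)) (inj₂ (inj₂ w)) = adj h u w
  adj (par g h) (inj₂ (inj₁ _)) (inj₂ (inj₂ _)) = false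
  adj (par g h) (inj₂ (inj₂ _)) (inj₂ (inj₁ _)) = false

  adj-sym : ∀ g u w → adj g u w ≡ adj g w u
  adj-sym k33 (inj₁ i) (inj₂ j) = refl
  adj-sym k33 (inj₂ j) (inj₁ i) = refl
  adj-sym k33 (inj₁ _) (inj₁ _) = refl
  adj-sym k33 (inj₂ _) (inj₂ _) = refl
  adj-sym (bridge g) (inj₁ zero) (inj₁ zero) = refl
  adj-sym (bridge g) (inj₁ zero) (inj₁ (suc zero)) = refl
  adj-sym (bridge g) (inj₁ (suc zero)) (inj₁ zero) = refl
  adj-sym (bridge g) (inj₁ (suc zero)) (inj₁ (suc zero)) = refl
  adj-sym (bridge g) (inj₁ i) (inj₂ w) = refl
  adj-sym (bridge g) (inj₂ u) (inj₁ i) = refl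
  adj-sym (bridge g) (inj₂ u) (inj₂ w) = adj-sym g u w
  adj-sym (par g h) (inj₁ _) (inj₁ _) = refl
  adj-sym (par g h) (inj₁ i) (inj₂ (inj₁ w)) = refl
  adj-sym (par g h) (inj₁ i) (inj₂ (inj₂ w)) = refl
  adj-sym (par g h) (inj₂ (inj₁ u)) (inj₁ i) = refl
  adj-sym (par g h) (inj₂ (inj₂ u)) (inj₁ i) = refl
  adj-sym (par g h) (inj₂ (inj₁ u)) (inj₂ (inj₁ w)) = adj-sym g u w
  adj-sym (par g h) (inj₂ (inj₂ u)) (inj₂ (inj₂ w)) = adj-sym h u w
  adj-sym (par g h) (inj₂ (inj₁ _)) (inj₂ (inj₂ _)) = refl
  adj-sym (par g h) (inj₂ (inj₂ _)) (inj₂ (inj₁ _)) = refl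

  -- Bipartition.

  side : Fin 2 → Bool
  side i = eq (leaf 2) (suc zero) i

  color : ∀ g → Vertex g → Bool
  color k33        (inj₁ _)        = false
  color k33        (inj₂ _)        = true
  color (bridge g) (inj₁ i)        = side i
  color (bridge g) (inj₂ u)        = not (color g u)
  color (par g h)  (inj₁ i)        = side i
  color (par g h)  (inj₂ (inj₁ u)) = not (color g u)
  color (par g h)  (inj₂ (inj₂ u)) = not (color h u)

  -- The invariant of the recursion: the two ports always have opposite colours. A new hub is
  -- adjacent to the port of the same index, hence the `not` on inner gadgets in `color`, and the
  -- two hubs can themselves be joined.
  color-port : ∀ g i → color g (port g i) ≡ side i
  color-port k33        zero       = refl
  color-port k33        (suc zero) = refl
  color-port (bridge g) i          = refl
  color-port (par g h)  i          = refl

  color-hub : ∀ g i w → eq (vertices g) (port g i) w ≡ true → side i ≡ not (not (color g w))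
  color-hub g i w p = trans (≡-sym (color-port g i))
    (trans (cong (color g) (eq-sound (vertices g) (port g i) w p)) (≡-sym (not-involutive _)))

  color-hub′ : ∀ g i w → eq (vertices g) (port g i) w ≡ true → not (color g w) ≡ not (side i)
  color-hub′ g i w p = cong not (trans (≡-sym (not-involutive _)) (≡-sym (color-hub g i w p)))

  -- The equational form, unlike an inequality, passes through the colour flip of an inner gadget by
  -- `cong not`.
  color-adj : ∀ g u w → adj g u w ≡ true → color g u ≡ not (color g w)
  color-adj k33 (inj₁ i) (inj₂ j) p = refl
  color-adj k33 (inj₂ j) (inj₁ i) p = refl
  color-adj (bridge g) (inj₁ zero)       (inj₁ (suc zero)) p = refl
  color-adj (bridge g) (inj₁ (suc zero)) (inj₁ zero)       p = refl
  color-adj (bridge g) (inj₁ (suc zero)) (inj₁ (suc zero)) ()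
  color-adj (bridge g) (inj₁ i) (inj₂ w) p = color-hub g i w p
  color-adj (bridge g) (inj₂ u) (inj₁ i) p = color-hub′ g i u p
  color-adj (bridge g) (inj₂ u) (inj₂ w) p = cong not (color-adj g u w p)
  color-adj (par g h) (inj₁ i) (inj₂ (inj₁ w)) p = color-hub g i w p
  color-adj (par g h) (inj₁ i) (inj₂ (inj₂ w)) p = color-hub h i w p
  color-adj (par g h) (inj₂ (inj₁ u)) (inj₁ i) p = color-hub′ g i u p
  color-adj (par g h) (inj₂ (inj₂ u)) (inj₁ i) p = color-hub′ h i u p
  color-adj (par g h) (inj₂ (inj₁ u)) (inj₂ (inj₁ w)) p = cong not (color-adj g u w p)
  color-adj (par g h) (inj₂ (inj₂ u)) (inj₂ (inj₂ w)) p = cong not (color-adj h u w p)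

  -- Degrees.

  deg : ∀ g → Vertex g → ℕ
  deg g u = ∑ (vertices g) (λ w → ⟦ adj g u w ⟧)

  portal : ∀ g → Vertex g → ℕ
  portal g u = ⟦ eq (vertices g) (port g zero) u ⟧ + ⟦ eq (vertices g) (port g (suc zero)) u ⟧

  +-shuffle : ∀ a b d → (a + (b + 0)) + d + 0 ≡ d + (a + b)
  +-shuffle = solve-∀

  -- `portal` counts the half-edges at a vertex. When a gadget is built into a larger one, these are
  -- exactly the new edges to the hubs, so the sum at an inner vertex is unchanged.
  deg-portal : ∀ g u → deg g u + portal g u ≡ 3
  deg-portal k33 (inj₁ zero)             = refl
  deg-portal k33 (inj₁ (suc zero))       = refl
  deg-portal k33 (inj₁ (suc (suc zero))) = refl
  deg-portal k33 (inj₂ zero)             = refl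
  deg-portal k33 (inj₂ (suc zero))       = refl
  deg-portal k33 (inj₂ (suc (suc zero))) = refl
  deg-portal (bridge g) (inj₁ zero)       rewrite ∑-eq (vertices g) (port g zero) = refl
  deg-portal (bridge g) (inj₁ (suc zero)) rewrite ∑-eq (vertices g) (port g (suc zero)) = refl
  deg-portal (bridge g) (inj₂ u) = trans (+-shuffle ⟦ eq (vertices g) (port g zero) u ⟧ _ (deg g u)) (deg-portal g u)
  deg-portal (par g h) (inj₁ zero)
    rewrite ∑-eq (vertices g) (port g zero) | ∑-eq (vertices h) (port h zero) = refl
  deg-portal (par g h) (inj₁ (suc zero))
    rewrite ∑-eq (vertices g) (port g (suc zero)) | ∑-eq (vertices h) (port h (suc zero)) = refl
  deg-portal (par g h) (inj₂ (inj₁ u))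
    rewrite ∑-zero (vertices h) | +-identityʳ (deg g u)
    = trans (+-shuffle ⟦ eq (vertices g) (port g zero) u ⟧ _ (deg g u)) (deg-portal g u)
  deg-portal (par g h) (inj₂ (inj₂ u))
    rewrite ∑-zero (vertices g)
    = trans (+-shuffle ⟦ eq (vertices h) (port h zero) u ⟧ _ (deg h u)) (deg-portal h u)

  -- Edges and cuts.

  -- S is a side for each vertex of the gadget, o for the far ends of its two half-edges.
  crosses : ∀ g → (Vertex g → Bool) → (Fin 2 → Bool) → El (outer g) → Bool
  crosses g          S o (inj₁ i)                      = o i xor S (port g i)
  crosses k33        S o (inj₂ (inj₁ j))               = S (inj₁ zero) xor S (inj₂ (suc j))
  crosses k33        S o (inj₂ (inj₂ (inj₁ i)))        = S (inj₁ (suc i)) xor S (inj₂ zero)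
  crosses k33        S o (inj₂ (inj₂ (inj₂ (inj₁ j)))) = S (inj₁ (suc zero)) xor S (inj₂ (suc j))
  crosses k33        S o (inj₂ (inj₂ (inj₂ (inj₂ j)))) = S (inj₁ (suc (suc zero))) xor S (inj₂ (suc j))
  crosses (bridge g) S o (inj₂ (inj₁ _)) = S (inj₁ zero) xor S (inj₁ (suc zero))
  crosses (bridge g) S o (inj₂ (inj₂ e)) = crosses g (S ∘ inj₂) (S ∘ inj₁) e
  crosses (par g h)  S o (inj₂ (inj₁ e)) = crosses g (S ∘ inj₂ ∘ inj₁) (S ∘ inj₁) e
  crosses (par g h)  S o (inj₂ (inj₂ e)) = crosses h (S ∘ inj₂ ∘ inj₂) (S ∘ inj₁) e

  -- The ends of an edge index are recorded through its crossing indicator for all vertex sets,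
  -- which is the only way in which the counting meets them.
  EdgeBetween : ∀ g → Vertex g → Vertex g → Set
  EdgeBetween g u w = ∃ λ (e : El (inner g)) → ∀ S o → crosses g S o (inj₂ e) ≡ S u xor S w

  flip-edge : ∀ g u w → EdgeBetween g u w → EdgeBetween g w u
  flip-edge g u w (e , p) = e , λ S o → trans (p S o) (xor-comm (S u) (S w))

  edge-k33 : ∀ i j → adj-k33 i j ≡ true → EdgeBetween k33 (inj₁ i) (inj₂ j)
  edge-k33 zero             (suc j) p = inj₁ j , λ S o → refl
  edge-k33 (suc i)          zero    p = inj₂ (inj₁ i) , λ S o → refl
  edge-k33 (suc zero)       (suc j) p = inj₂ (inj₂ (inj₁ j)) , λ S o → refl
  edge-k33 (suc (suc zero)) (suc j) p = inj₂ (inj₂ (inj₂ j)) , λ S o → refl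

  edge-bridge : ∀ g i w → eq (vertices g) (port g i) w ≡ true → EdgeBetween (bridge g) (inj₁ i) (inj₂ w)
  edge-bridge g i w p with refl ← eq-sound (vertices g) (port g i) w p = inj₂ (inj₁ i) , λ S o → refl

  edge-parˡ : ∀ g h i w → eq (vertices g) (port g i) w ≡ true →
    EdgeBetween (par g h) (inj₁ i) (inj₂ (inj₁ w))
  edge-parˡ g h i w p with refl ← eq-sound (vertices g) (port g i) w p = inj₁ (inj₁ i) , λ S o → refl

  edge-parʳ : ∀ g h i w → eq (vertices h) (port h i) w ≡ true →
    EdgeBetween (par g h) (inj₁ i) (inj₂ (inj₂ w))
  edge-parʳ g h i w p with refl ← eq-sound (vertices h) (port h i) w p = inj₂ (inj₁ i) , λ S o → refl

  edge : ∀ g u w → adj g u w ≡ true → EdgeBetween g u w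
  edge k33 (inj₁ i) (inj₂ j) p = edge-k33 i j p
  edge k33 (inj₂ j) (inj₁ i) p = flip-edge k33 (inj₁ i) (inj₂ j) (edge-k33 i j p)
  edge (bridge g) (inj₁ zero)       (inj₁ (suc zero)) p = inj₁ zero , λ S o → refl
  edge (bridge g) (inj₁ (suc zero)) (inj₁ zero)       p =
    flip-edge (bridge g) (inj₁ zero) (inj₁ (suc zero)) (inj₁ zero , λ S o → refl)
  edge (bridge g) (inj₁ (suc zero)) (inj₁ (suc zero)) ()
  edge (bridge g) (inj₁ i) (inj₂ w) p = edge-bridge g i w p
  edge (bridge g) (inj₂ u) (inj₁ i) p = flip-edge (bridge g) (inj₁ i) (inj₂ u) (edge-bridge g i u p)
  edge (bridge g) (inj₂ u) (inj₂ w) p with e , q ← edge g u w p = inj₂ (inj₂ e) , λ S o → q (S ∘ inj₂) (S ∘ inj₁)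
  edge (par g h) (inj₁ i) (inj₂ (inj₁ w)) p = edge-parˡ g h i w p
  edge (par g h) (inj₁ i) (inj₂ (inj₂ w)) p = edge-parʳ g h i w p
  edge (par g h) (inj₂ (inj₁ u)) (inj₁ i) p = flip-edge (par g h) (inj₁ i) (inj₂ (inj₁ u)) (edge-parˡ g h i u p)
  edge (par g h) (inj₂ (inj₂ u)) (inj₁ i) p = flip-edge (par g h) (inj₁ i) (inj₂ (inj₂ u)) (edge-parʳ g h i u p)
  edge (par g h) (inj₂ (inj₁ u)) (inj₂ (inj₁ w)) p with e , q ← edge g u w p =
    inj₁ (inj₂ e) , λ S o → q (S ∘ inj₂ ∘ inj₁) (S ∘ inj₁)
  edge (par g h) (inj₂ (inj₂ u)) (inj₂ (inj₂ w)) p with e , q ← edge h u w p =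
    inj₂ (inj₂ e) , λ S o → q (S ∘ inj₂ ∘ inj₂) (S ∘ inj₁)

  crosses-const : ∀ g b o e → crosses g (const b) o (inj₂ e) ≡ false
  crosses-const k33 b o (inj₁ _)                      = xor-same b
  crosses-const k33 b o (inj₂ (inj₁ _))               = xor-same b
  crosses-const k33 b o (inj₂ (inj₂ (inj₁ _)))        = xor-same b
  crosses-const k33 b o (inj₂ (inj₂ (inj₂ _)))        = xor-same b
  crosses-const (bridge g) b o (inj₁ _)               = xor-same b
  crosses-const (bridge g) b o (inj₂ (inj₁ i))        = xor-same b
  crosses-const (bridge g) b o (inj₂ (inj₂ e))        = crosses-const g b (const b) e
  crosses-const (par g h)  b o (inj₁ (inj₁ i))        = xor-same b
  crosses-const (par g h)  b o (inj₁ (inj₂ e))        = crosses-const g b (const b) e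
  crosses-const (par g h)  b o (inj₂ (inj₁ i))        = xor-same b
  crosses-const (par g h)  b o (inj₂ (inj₂ e))        = crosses-const h b (const b) e

  infixr 7 _⊙_

  _⊙_ : Bool → ℕ → ℕ
  b ⊙ n = if b then n else 0

  cut : ∀ g → (Vertex g → Bool) → (Fin 2 → Bool) → (El (outer g) → ℕ) → ℕ
  cut g S o m = ∑ (outer g) (λ e → crosses g S o e ⊙ m e)

  -- A gadget lying wholly on one side is crossed only at its half-edges. This evaluates cuts of a
  -- composite gadget that do not split a part.
  cut-const : ∀ g b o m → cut g (const b) o m ≡
    (o zero xor b) ⊙ m (inj₁ zero) + (o (suc zero) xor b) ⊙ m (inj₁ (suc zero))
  cut-const g b o m = begin
    x + (y + 0) + ∑ (inner g) (λ e → crosses g (const b) o (inj₂ e) ⊙ m (inj₂ e))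
      ≡⟨ cong (x + (y + 0) +_) (∑-cong (inner g) λ e → cong (_⊙ m (inj₂ e)) (crosses-const g b o e)) ⟩
    x + (y + 0) + ∑ (inner g) (const 0)
      ≡⟨ cong₂ _+_ (cong (x +_) (+-identityʳ y)) (∑-zero (inner g)) ⟩
    x + y + 0
      ≡⟨ +-identityʳ (x + y) ⟩
    x + y ∎
    where
    open ≡-Reasoning
    x y : ℕ
    x = (o zero xor b) ⊙ m (inj₁ zero)
    y = (o (suc zero) xor b) ⊙ m (inj₁ (suc zero))

  -- Cut conditions and bounds on the load.

  Balanced : ℕ → Set
  Balanced n = parity n ≡ 0ℙ × 2 ≤ n

  -- The vertex `u` witnesses that the set is nonempty, and the far ends of the half-edges lie
  -- outside it. Such a set stays proper in any surrounding graph, so multiplicities coming from a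
  -- tour satisfy the condition.
  Valid : ∀ g → (El (outer g) → ℕ) → Set
  Valid g m = ∀ S u → S u ≡ true → Balanced (cut g S (const false) m)

  Odd Even : ℕ → Set
  Odd n  = parity n ≡ 1ℙ
  Even n = parity n ≡ 0ℙ

  -- p and q are the multiplicities at the ports and F the total over all edges of outer.
  StrongBound WeakBound : (B p q F : ℕ) → Set
  StrongBound B p q F = (Odd p × Odd q × B + 1 ≤ F) ⊎ (Even p × Even q × B + 2 ≤ F)
  WeakBound   B p q F = (Odd p × Odd q × B + 1 ≤ F) ⊎ (Even p × Even q × B + (p + q) ≤ 2 + F)

  -- `Weak` is what a parallel pair achieves: its even case is `F` at least `B + p + q − 2`, with
  -- the subtraction moved across, so it falls to `B` when `p + q` is 2. A subsequent `bridge`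
  -- restores `Strong`.
  Strong Weak : Gadget → ℕ → Set
  Strong g B = ∀ m → Valid g m → StrongBound B (m (inj₁ zero)) (m (inj₁ (suc zero))) (∑ (outer g) m)
  Weak   g B = ∀ m → Valid g m → WeakBound B (m (inj₁ zero)) (m (inj₁ (suc zero))) (∑ (outer g) m)

  parity? : ∀ n → Odd n ⊎ Even n
  parity? n with parity n
  ... | 1ℙ = inj₁ refl
  ... | 0ℙ = inj₂ refl

  odd⇒1≤ : ∀ n → Odd n → 1 ≤ n
  odd⇒1≤ (suc n) _ = s≤s z≤n

  even⇒0⊎2≤ : ∀ n → Even n → n ≡ 0 ⊎ 2 ≤ n
  even⇒0⊎2≤ zero        _ = inj₁ refl
  even⇒0⊎2≤ (suc (suc n)) _ = inj₂ (s≤s (s≤s z≤n))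

  parity-of-rest : ∀ a b {x} → Even (a + b) → parity a ≡ x → parity b ≡ x
  parity-of-rest a b even refl with parity a | parity b | trans (≡-sym (parity-+ a b)) even
  ... | 0ℙ | 0ℙ | _ = refl
  ... | 1ℙ | 1ℙ | _ = refl

  parity-of-middle : ∀ a b c {x y} → Even (a + b + c) → parity a ≡ x → parity c ≡ y → parity b ≡ x ℙ.+ y
  parity-of-middle a b c even refl refl =
    parity-of-rest (a + c) b (trans (cong parity (swap a b c)) even) (parity-+ a c)
    where swap : ∀ a b c → a + c + b ≡ a + b + c
          swap = solve-∀

  -- Arithmetic of the two constructions.

  -- If `f` and `g` are both nonzero they give 4 and `p + q` gives 2. Otherwise `f + g` still gives
  -- 2, and either `e` and `p + q` give 2 each, or `e` vanishes and the cuts containing the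
  -- vanishing one of `f`, `g` force both `p` and `q` to be at least 2.
  six≤load : ∀ p q e f g → Even e → Even f → Even g →
    2 ≤ p + q → 2 ≤ f + g → 2 ≤ p + e + f → 2 ≤ q + e + g → 2 ≤ p + e + g → 2 ≤ q + e + f →
    6 ≤ (f + g) + ((p + q) + e)
  six≤load p q e f g ee ef eg pq fg pef qeg peg qef with even⇒0⊎2≤ f ef | even⇒0⊎2≤ g eg | even⇒0⊎2≤ e ee
  ... | inj₁ refl | _         | inj₂ 2≤e  = +-mono-≤ fg (+-mono-≤ pq 2≤e)
  ... | inj₁ refl | _         | inj₁ refl = +-mono-≤ fg (subst (4 ≤_) (drop p q) (+-mono-≤ pef qef))
    where drop : ∀ p q → p + 0 + 0 + (q + 0 + 0) ≡ p + q + 0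
          drop = solve-∀
  ... | inj₂ _    | inj₁ refl | inj₂ 2≤e  = +-mono-≤ fg (+-mono-≤ pq 2≤e)
  ... | inj₂ _    | inj₁ refl | inj₁ refl = +-mono-≤ fg (subst (4 ≤_) (drop p q) (+-mono-≤ peg qeg))
    where drop : ∀ p q → p + 0 + 0 + (q + 0 + 0) ≡ p + q + 0
          drop = solve-∀
  ... | inj₂ 2≤f  | inj₂ 2≤g  | _         = +-mono-≤ (+-mono-≤ 2≤f 2≤g) (≤-trans pq (m≤m+n (p + q) e))

  -- Here `e` is the edge between the new ports and `f`, `g` lead to the inner gadget. Parity at a
  -- new port makes `e` odd when `p` and `f` differ in parity, and this one extra step settles both
  -- mixed cases. If both are odd, `p + q` suffices; if both are even, `six≤load` is used.
  bridge-arith : ∀ B p q e f g F →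
    WeakBound B f g F →
    Balanced (p + q) → Balanced (f + g) → Balanced (p + e + f) → Balanced (q + e + g) →
    2 ≤ p + e + g → 2 ≤ q + e + f →
    StrongBound (B + 2) p q (p + q + e + F)
  bridge-arith B p q e f g F bound (epq , pq) (_ , fg) (epef , pef) (_ , qeg) peg qef
    with parity? p | bound
  ... | inj₁ op | inj₁ (_ , _ , B≤F) = inj₁ (op , parity-of-rest p q epq op , (begin
    B + 2 + 1      ≡⟨ solve (B ∷ []) ⟩
    2 + (B + 1)    ≤⟨ +-mono-≤ (≤-trans pq (m≤m+n (p + q) e)) B≤F ⟩
    p + q + e + F  ∎))
    where open ≤-Reasoning
  ... | inj₁ op | inj₂ (ef , _ , B≤F) = inj₁ (op , parity-of-rest p q epq op , +-cancelˡ-≤ 2 _ _ (begin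
    2 + (B + 2 + 1)            ≡⟨ solve (B ∷ []) ⟩
    2 + 1 + (B + 2)            ≤⟨ +-mono-≤ (+-mono-≤ pq (odd⇒1≤ e oe)) (+-monoʳ-≤ B fg) ⟩
    p + q + e + (B + (f + g))  ≤⟨ +-monoʳ-≤ (p + q + e) B≤F ⟩
    p + q + e + (2 + F)        ≡⟨ solve (p ∷ q ∷ e ∷ F ∷ []) ⟩
    2 + (p + q + e + F)        ∎))
    where open ≤-Reasoning
          oe : Odd e
          oe = parity-of-middle p e f epef op ef
  ... | inj₂ ep | inj₁ (of , _ , B≤F) = inj₂ (ep , parity-of-rest p q epq ep , (begin
    B + 2 + 2        ≡⟨ solve (B ∷ []) ⟩
    2 + 1 + (B + 1)  ≤⟨ +-mono-≤ (+-mono-≤ pq (odd⇒1≤ e oe)) B≤F ⟩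
    p + q + e + F    ∎))
    where open ≤-Reasoning
          oe : Odd e
          oe = parity-of-middle p e f epef ep of
  -- The inner bound is short by 2 in this case, so a load of 6 on the five edges `p`, `q`, `e`,
  -- `f`, `g` is what yields the required gain of 4.
  ... | inj₂ ep | inj₂ (ef , eg , B≤F) = inj₂ (ep , parity-of-rest p q epq ep , +-cancelˡ-≤ 2 _ _ (begin
    2 + (B + 2 + 2)            ≡⟨ solve (B ∷ []) ⟩
    B + 6                      ≤⟨ +-monoʳ-≤ B (six≤load p q e f g ee ef eg pq fg pef qeg peg qef) ⟩
    B + (f + g + (p + q + e))  ≡⟨ solve (B ∷ f ∷ g ∷ p ∷ q ∷ e ∷ []) ⟩
    p + q + e + (B + (f + g))  ≤⟨ +-monoʳ-≤ (p + q + e) B≤F ⟩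
    p + q + e + (2 + F)        ≡⟨ solve (p ∷ q ∷ e ∷ F ∷ []) ⟩
    2 + (p + q + e + F)        ∎))
    where open ≤-Reasoning
          ee : Even e
          ee = parity-of-middle p e f epef ep ef

  -- Evenness at the hubs makes `f` and `g` even when the two parts have the same parity and odd
  -- otherwise. In the first case each part gives at least `B + 1`; in the second the parts give
  -- `2 * B + 3` together and `f`, `g` add at least 1 each.
  par-arith : ∀ B f g p₁ q₁ F₁ p₂ q₂ F₂ →
    StrongBound B p₁ q₁ F₁ → StrongBound B p₂ q₂ F₂ →
    Even (p₁ + f + p₂) → Even (q₁ + g + q₂) →
    WeakBound (2 * B + 4) f g (f + g + (F₁ + F₂))
  par-arith B f g p₁ q₁ F₁ p₂ q₂ F₂ H₁ H₂ ep eq = go H₁ H₂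
    where
    open ≤-Reasoning
    mixed : ∀ {x y} → Odd f → Odd g → B + x ≤ F₁ → B + y ≤ F₂ → x + y ≡ 3 →
      2 * B + 4 + 1 ≤ f + g + (F₁ + F₂)
    mixed {x} {y} of og B≤F₁ B≤F₂ x+y≡3 = begin
      2 * B + 4 + 1                ≡⟨ solve (B ∷ []) ⟩
      1 + 1 + (B + B + 3)          ≡⟨ cong (λ z → 2 + (B + B + z)) x+y≡3 ⟨
      1 + 1 + (B + B + (x + y))    ≡⟨ cong (2 +_) (+-interchange B B x y) ⟩
      1 + 1 + (B + x + (B + y))    ≤⟨ +-mono-≤ (+-mono-≤ (odd⇒1≤ f of) (odd⇒1≤ g og)) (+-mono-≤ B≤F₁ B≤F₂) ⟩
      f + g + (F₁ + F₂)            ∎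
    alike : ∀ {x} → 1 ≤ x → B + x ≤ F₁ → B + x ≤ F₂ →
      2 * B + 4 + (f + g) ≤ 2 + (f + g + (F₁ + F₂))
    alike {x} 1≤x B≤F₁ B≤F₂ = begin
      2 * B + 4 + (f + g)              ≡⟨ solve (B ∷ f ∷ g ∷ []) ⟩
      2 + (f + g + (B + 1 + (B + 1)))  ≤⟨ +-monoʳ-≤ 2 (+-monoʳ-≤ (f + g) (+-mono-≤
                                            (≤-trans (+-monoʳ-≤ B 1≤x) B≤F₁) (≤-trans (+-monoʳ-≤ B 1≤x) B≤F₂))) ⟩
      2 + (f + g + (F₁ + F₂))          ∎
    go : StrongBound B p₁ q₁ F₁ → StrongBound B p₂ q₂ F₂ → WeakBound (2 * B + 4) f g (f + g + (F₁ + F₂))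
    go (inj₁ (op₁ , oq₁ , b₁)) (inj₁ (op₂ , oq₂ , b₂)) =
      inj₂ (parity-of-middle p₁ f p₂ ep op₁ op₂ , parity-of-middle q₁ g q₂ eq oq₁ oq₂ , alike (s≤s z≤n) b₁ b₂)
    go (inj₂ (ep₁ , eq₁ , b₁)) (inj₂ (ep₂ , eq₂ , b₂)) =
      inj₂ (parity-of-middle p₁ f p₂ ep ep₁ ep₂ , parity-of-middle q₁ g q₂ eq eq₁ eq₂ , alike (s≤s z≤n) b₁ b₂)
    go (inj₁ (op₁ , oq₁ , b₁)) (inj₂ (ep₂ , eq₂ , b₂)) = inj₁ (of , og , mixed of og b₁ b₂ refl)
      where of : Odd f
            of = parity-of-middle p₁ f p₂ ep op₁ ep₂
            og : Odd g
            og = parity-of-middle q₁ g q₂ eq oq₁ eq₂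
    go (inj₂ (ep₁ , eq₁ , b₁)) (inj₁ (op₂ , oq₂ , b₂)) = inj₁ (of , og , mixed of og b₁ b₂ refl)
      where of : Odd f
            of = parity-of-middle p₁ f p₂ ep ep₁ op₂
            og : Odd g
            og = parity-of-middle q₁ g q₂ eq eq₁ oq₂

  -- The base gadget: K₃,₃ minus an edge.

  -- The bracketed terms are the normal forms of six vertex cuts, one of them (at the port with
  -- multiplicity q) taken around the complement of the vertex, which exchanges p and q.
  k33-handshake : ∀ p q a b c d s t u v →
    (p + 0 + (a + (b + 0) + 0)) + (p + 0 + (c + (d + 0) + 0)) +
    (((a + 0 + (s + 0 + (u + 0))) + (b + 0 + (t + 0 + (v + 0)))) +
    ((c + 0 + (s + (t + 0) + 0)) + (d + 0 + (u + (v + 0))))) + (q + q) ≡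
    2 * (p + (q + 0) + (a + (b + 0) + (c + (d + 0) + (s + (t + 0) + (u + (v + 0))))))
  k33-handshake = solve-∀

  k33-handshake′ : ∀ p q a b c d s t u v →
    (q + 0 + (a + (b + 0) + 0)) + (q + 0 + (c + (d + 0) + 0)) +
    (((a + 0 + (s + 0 + (u + 0))) + (b + 0 + (t + 0 + (v + 0)))) +
    ((c + 0 + (s + (t + 0) + 0)) + (d + 0 + (u + (v + 0))))) + (p + p) ≡
    2 * (p + (q + 0) + (a + (b + 0) + (c + (d + 0) + (s + (t + 0) + (u + (v + 0))))))
  k33-handshake′ = solve-∀

  -- Six cuts of size at least 2 give the 12. Taking the complement at port `i` makes them count the
  -- half-edge at the other port twice and the one at port `i` not at all, while each inner edge
  -- counts twice. Hence twice the multiplicity at port `i` can be added on top.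
  k33-bound : ∀ m → Valid k33 m → ∀ i k → k ≤ m (inj₁ i) → 12 + (k + k) ≤ 2 * ∑ (outer k33) m
  k33-bound m valid i k k≤ = bound i k≤
    where
    outside : ∀ v u → not (eq (vertices k33) v u) ≡ true → _
    outside v u p = proj₂ (valid (not ∘ eq (vertices k33) v) u p)
    around : ∀ v → _
    around v = proj₂ (valid (eq (vertices k33) v) v (eq-refl (vertices k33) v))
    interior : 8 ≤ _
    interior = +-mono-≤ (+-mono-≤ (around (inj₂ (suc zero))) (around (inj₂ (suc (suc zero)))))
                        (+-mono-≤ (around (inj₁ (suc zero))) (around (inj₁ (suc (suc zero)))))
    edges : El (inner k33) → ℕ
    edges e = m (inj₂ e)
    bound : ∀ i → k ≤ m (inj₁ i) → 12 + (k + k) ≤ 2 * ∑ (outer k33) m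
    bound (suc zero) k≤ = ≤-trans
      (+-mono-≤ (+-mono-≤ (+-mono-≤ (around (inj₁ zero)) (outside (inj₂ zero) (inj₁ zero) refl)) interior)
        (+-mono-≤ k≤ k≤))
      (≤-reflexive (k33-handshake (m (inj₁ zero)) (m (inj₁ (suc zero)))
        (edges (inj₁ zero)) (edges (inj₁ (suc zero)))
        (edges (inj₂ (inj₁ zero))) (edges (inj₂ (inj₁ (suc zero))))
        (edges (inj₂ (inj₂ (inj₁ zero)))) (edges (inj₂ (inj₂ (inj₁ (suc zero)))))
        (edges (inj₂ (inj₂ (inj₂ zero)))) (edges (inj₂ (inj₂ (inj₂ (suc zero)))))))
    bound zero k≤ = ≤-trans
      (+-mono-≤ (+-mono-≤ (+-mono-≤ (outside (inj₁ zero) (inj₂ zero) refl) (around (inj₂ zero))) interior)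
        (+-mono-≤ k≤ k≤))
      (≤-reflexive (k33-handshake′ (m (inj₁ zero)) (m (inj₁ (suc zero)))
        (edges (inj₁ zero)) (edges (inj₁ (suc zero)))
        (edges (inj₂ (inj₁ zero))) (edges (inj₂ (inj₁ (suc zero))))
        (edges (inj₂ (inj₂ (inj₁ zero)))) (edges (inj₂ (inj₂ (inj₁ (suc zero)))))
        (edges (inj₂ (inj₂ (inj₂ zero)))) (edges (inj₂ (inj₂ (inj₂ (suc zero)))))))

  k33-strong : Strong k33 6
  k33-strong m valid = bound
    where
    p q F : ℕ
    p = m (inj₁ zero)
    q = m (inj₁ (suc zero))
    F = ∑ (outer k33) m
    p+q : Balanced (p + q)
    p+q = subst Balanced (cut-const k33 true (const false) m) (valid (const true) (inj₁ zero) refl)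
    bound : StrongBound 6 p q F
    bound with parity? p
    ... | inj₁ op = inj₁ (op , parity-of-rest p q (proj₁ p+q) op ,
      *-cancelˡ-≤ 2 (k33-bound m valid zero 1 (odd⇒1≤ p op)))
    ... | inj₂ ep = inj₂ (ep , even-q , *-cancelˡ-≤ 2 (two (even⇒0⊎2≤ p ep)))
      where
      even-q : Even q
      even-q = parity-of-rest p q (proj₁ p+q) ep
      two : p ≡ 0 ⊎ 2 ≤ p → 16 ≤ 2 * F
      two (inj₁ p≡0) = k33-bound m valid (suc zero) 2 (subst (λ x → 2 ≤ x + q) p≡0 (proj₂ p+q))
      two (inj₂ 2≤p) = k33-bound m valid zero 2 2≤p

  -- Transfer of the bounds through `bridge` and `par`.

  zeros₁ : ∀ p q → p + (q + 0) + 0 ≡ p + q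
  zeros₁ = solve-∀

  zeros₂ : ∀ p e f → p + 0 + (e + 0 + f) ≡ p + e + f
  zeros₂ = solve-∀

  zeros₃ : ∀ p e f → p + 0 + (e + 0 + (f + 0)) ≡ p + e + f
  zeros₃ = solve-∀

  zeros₄ : ∀ f p q → f + 0 + (p + q) ≡ p + f + q
  zeros₄ = solve-∀

  zeros₅ : ∀ f p q → f + 0 + (p + 0 + (q + 0)) ≡ p + f + q
  zeros₅ = solve-∀

  zeros₆ : ∀ p q e F → p + q + e + F ≡ p + (q + 0) + (e + 0 + F)
  zeros₆ = solve-∀

  bridge-strong : ∀ g {B} → Weak g B → Strong (bridge g) (B + 2)
  bridge-strong g {B} weak m valid = subst (StrongBound (B + 2) p q) (zeros₆ p q e (∑ (outer g) m′))
    (bridge-arith B p q e (m′ (inj₁ zero)) (m′ (inj₁ (suc zero))) (∑ (outer g) m′) (weak m′ valid′)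
      -- The six cuts are, in order: the whole gadget, the inner gadget, each new port alone, and
      -- each new port together with the inner gadget.
      (cut-at (const true) true (inj₁ zero) refl (zeros₁ p q))
      (cut-at (const false) true (inj₂ (port g zero)) refl refl)
      (cut-at left false (inj₁ zero) refl (zeros₃ p e f))
      (cut-at right false (inj₁ (suc zero)) refl (zeros₂ q e f′))
      (proj₂ (cut-at left true (inj₁ zero) refl (zeros₂ p e f′)))
      (proj₂ (cut-at right true (inj₁ (suc zero)) refl (zeros₃ q e f))))
    where
    m′ : El (outer g) → ℕ
    m′ e = m (inj₂ (inj₂ e))
    p q e f f′ : ℕ
    p = m (inj₁ zero)
    q = m (inj₁ (suc zero))
    e = m (inj₂ (inj₁ zero))
    f = m′ (inj₁ zero)
    f′ = m′ (inj₁ (suc zero))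
    valid′ : Valid g m′
    valid′ S u p = valid [ const false , S ]′ (inj₂ u) p
    left right : Fin 2 → Bool
    left  = eq (leaf 2) zero
    right = eq (leaf 2) (suc zero)
    cut-at : ∀ (s : Fin 2 → Bool) b u → [ s , const b ]′ u ≡ true → ∀ {n} →
      s zero ⊙ p + (s (suc zero) ⊙ q + 0) +
        ((s zero xor s (suc zero)) ⊙ e + 0 + ((s zero xor b) ⊙ f + (s (suc zero) xor b) ⊙ f′)) ≡ n →
      Balanced n
    cut-at s b u su refl = subst (λ x → Balanced (s zero ⊙ p + (s (suc zero) ⊙ q + 0) +
      ((s zero xor s (suc zero)) ⊙ e + 0 + x))) (cut-const g b s m′) (valid [ s , const b ]′ u su)

  par-weak : ∀ g h {B} → Strong g B → Strong h B → Weak (par g h) (2 * B + 4)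
  par-weak g h {B} strong₁ strong₂ m valid = subst (WeakBound (2 * B + 4) f f′)
    (cong (λ x → f + x + (∑ (outer g) m₁ + ∑ (outer h) m₂)) (≡-sym (+-identityʳ f′)))
    (par-arith B f f′ p₁ q₁ (∑ (outer g) m₁) p₂ q₂ (∑ (outer h) m₂)
      -- A set inside `g` is extended by false to the hubs and to `h`; then `h` contributes nothing
      -- to the cut.
      (strong₁ m₁ λ S u p → subst Balanced (trans (cong (cut g S (const false) m₁ +_) (cut-const h false (const false) m₂))
                                                  (+-identityʳ _))
                              (valid [ const false , [ S , const false ]′ ]′ (inj₂ (inj₁ u)) p))
      (strong₂ m₂ λ S u p → subst Balanced (cong (_+ cut h S (const false) m₂) (cut-const g false (const false) m₁))
                              (valid [ const false , [ const false , S ]′ ]′ (inj₂ (inj₂ u)) p))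
      (hub-even zero (zeros₅ f p₁ p₂)) (hub-even (suc zero) (zeros₄ f′ q₁ q₂)))
    where
    m₁ : El (outer g) → ℕ
    m₁ e = m (inj₂ (inj₁ e))
    m₂ : El (outer h) → ℕ
    m₂ e = m (inj₂ (inj₂ e))
    f f′ p₁ q₁ p₂ q₂ : ℕ
    f  = m (inj₁ zero)
    f′ = m (inj₁ (suc zero))
    p₁ = m₁ (inj₁ zero)
    q₁ = m₁ (inj₁ (suc zero))
    p₂ = m₂ (inj₁ zero)
    q₂ = m₂ (inj₁ (suc zero))
    hub-even : ∀ i → let s = eq (leaf 2) i in ∀ {n} →
      s zero ⊙ f + (s (suc zero) ⊙ f′ + 0) +
        ((s zero xor false) ⊙ p₁ + (s (suc zero) xor false) ⊙ q₁ +
         ((s zero xor false) ⊙ p₂ + (s (suc zero) xor false) ⊙ q₂)) ≡ n →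
      Even n
    hub-even i refl = subst Even
      (cong₂ (λ x y → s zero ⊙ f + (s (suc zero) ⊙ f′ + 0) + (x + y)) (cut-const g false s m₁) (cut-const h false s m₂))
      (proj₁ (valid [ s , const false ]′ (inj₁ i) (eq-refl (leaf 2) i)))
      where s = eq (leaf 2) i

  -- Connectivity after the removal of a vertex.

  -- Both ends of every step satisfy `P`; an empty path therefore says nothing about its single
  -- vertex, and membership of that vertex is supplied separately.
  Link : ∀ {V : Set} → (V → V → Bool) → (V → Set) → V → V → Set
  Link A P u w = A u w ≡ true × P u × P w

  Path : ∀ g → (Vertex g → Set) → Vertex g → Vertex g → Set
  Path g P = Star (Link (adj g) P)

  port-adj : ∀ g i → eq (vertices g) (port g i) (port g i) ≡ true
  port-adj g i = eq-refl (vertices g) (port g i)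

  exit-bridge : ∀ g {P u} i → P (inj₁ i) → P (inj₂ (port g i)) →
    Path g (P ∘ inj₂) u (port g i) → Path (bridge g) P (inj₂ u) (inj₁ i)
  exit-bridge g i pi pp path = gmap inj₂ id path ◅◅ (port-adj g i , pp , pi) ◅ ε

  exit-parˡ : ∀ g h {P u} i → P (inj₁ i) → P (inj₂ (inj₁ (port g i))) →
    Path g (P ∘ inj₂ ∘ inj₁) u (port g i) → Path (par g h) P (inj₂ (inj₁ u)) (inj₁ i)
  exit-parˡ g h i pi pp path = gmap (inj₂ ∘ inj₁) id path ◅◅ (port-adj g i , pp , pi) ◅ ε

  exit-parʳ : ∀ g h {P u} i → P (inj₁ i) → P (inj₂ (inj₂ (port h i))) →
    Path h (P ∘ inj₂ ∘ inj₂) u (port h i) → Path (par g h) P (inj₂ (inj₂ u)) (inj₁ i)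
  exit-parʳ g h i pi pp path = gmap (inj₂ ∘ inj₂) id path ◅◅ (port-adj h i , pp , pi) ◅ ε

  reach-port : ∀ g {P} → (∀ w → P w) → ∀ u i → Path g P u (port g i)
  reach-port k33 {P} all = go
    where
    hop : ∀ {u w} → adj k33 u w ≡ true → Link (adj k33) P u w
    hop a = a , all _ , all _
    go : ∀ u i → Path k33 P u (port k33 i)
    go (inj₁ zero)    zero       = ε
    go (inj₁ (suc a)) zero       = hop {w = inj₂ (suc zero)} refl ◅ hop refl ◅ ε
    go (inj₂ zero)    zero       = hop {w = inj₁ (suc zero)} refl ◅ hop {w = inj₂ (suc zero)} refl ◅ hop refl ◅ ε
    go (inj₂ (suc b)) zero       = hop refl ◅ ε
    go (inj₂ zero)    (suc zero) = ε
    go (inj₂ (suc b)) (suc zero) = hop {w = inj₁ (suc zero)} refl ◅ hop refl ◅ ε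
    go (inj₁ zero)    (suc zero) = hop {w = inj₂ (suc zero)} refl ◅ hop {w = inj₁ (suc zero)} refl ◅ hop refl ◅ ε
    go (inj₁ (suc a)) (suc zero) = hop refl ◅ ε
  reach-port (bridge g) all (inj₂ u) i = exit-bridge g i (all _) (all _) (reach-port g (all ∘ inj₂) u i)
  reach-port (bridge g) all (inj₁ zero)       zero       = ε
  reach-port (bridge g) all (inj₁ zero)       (suc zero) = (refl , all _ , all _) ◅ ε
  reach-port (bridge g) all (inj₁ (suc zero)) zero       = (refl , all _ , all _) ◅ ε
  reach-port (bridge g) all (inj₁ (suc zero)) (suc zero) = ε
  -- The hubs of a parallel pair are not adjacent, so the path runs through `g`.
  reach-port (par g h) all (inj₁ j) i = (port-adj g j , all _ , all _) ◅
    exit-parˡ g h i (all _) (all _) (reach-port g (all ∘ inj₂ ∘ inj₁) (port g j) i)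
  reach-port (par g h) all (inj₂ (inj₁ u)) i =
    exit-parˡ g h i (all _) (all _) (reach-port g (all ∘ inj₂ ∘ inj₁) u i)
  reach-port (par g h) all (inj₂ (inj₂ u)) i =
    exit-parʳ g h i (all _) (all _) (reach-port h (all ∘ inj₂ ∘ inj₂) u i)

  other : Fin 2 → Fin 2
  other zero       = suc zero
  other (suc zero) = zero

  other-≢ : ∀ i → other i ≢ i
  other-≢ zero       ()
  other-≢ (suc zero) ()

  Escape : ∀ g → Vertex g → Vertex g → Set
  Escape g v u = ∃ λ i → port g i ≢ v × Path g (_≢ v) u (port g i)

  escape-k33 : ∀ v u → u ≢ v → Escape k33 v u
  escape-k33 v              (inj₁ zero)    u≢v = zero , u≢v , ε
  escape-k33 v              (inj₂ zero)    u≢v = suc zero , u≢v , ε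
  escape-k33 (inj₂ zero)    (inj₁ (suc a)) u≢v = zero , (λ ()) ,
    _◅_ {j = inj₂ (suc zero)} (refl , (λ ()) , (λ ())) ((refl , (λ ()) , (λ ())) ◅ ε)
  escape-k33 (inj₂ (suc b)) (inj₁ (suc a)) u≢v = suc zero , (λ ()) , (refl , u≢v , (λ ())) ◅ ε
  escape-k33 (inj₁ _)       (inj₁ (suc a)) u≢v = suc zero , (λ ()) , (refl , u≢v , (λ ())) ◅ ε
  escape-k33 (inj₁ zero)    (inj₂ (suc b)) u≢v = suc zero , (λ ()) ,
    _◅_ {j = inj₁ (suc zero)} (refl , (λ ()) , (λ ())) ((refl , (λ ()) , (λ ())) ◅ ε)
  escape-k33 (inj₁ (suc a)) (inj₂ (suc b)) u≢v = zero , (λ ()) , (refl , u≢v , (λ ())) ◅ ε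
  escape-k33 (inj₂ _)       (inj₂ (suc b)) u≢v = zero , (λ ()) , (refl , u≢v , (λ ())) ◅ ε

  -- If a hub is removed, the part containing `u` is intact and is left by the other hub. If the
  -- removed vertex is in the same part as `u`, the induction hypothesis names a surviving port; if
  -- it is in the other part, any port will do.
  escape : ∀ g v u → u ≢ v → Escape g v u
  escape k33 v u u≢v = escape-k33 v u u≢v
  escape (bridge g) v (inj₁ i) u≢v = i , u≢v , ε
  escape (bridge g) (inj₁ j) (inj₂ u) u≢v =
    other j , (other-≢ j ∘ inj₁-injective) ,
    exit-bridge g (other j) (other-≢ j ∘ inj₁-injective) (λ ()) (reach-port g (λ _ ()) u (other j))
  escape (bridge g) (inj₂ v) (inj₂ u) u≢v with i , p≢v , path ← escape g v u (u≢v ∘ cong inj₂) =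
    i , (λ ()) , exit-bridge g i (λ ()) (p≢v ∘ inj₂-injective)
      (gmap id (λ (a , x , y) → a , x ∘ inj₂-injective , y ∘ inj₂-injective) path)
  escape (par g h) v (inj₁ i) u≢v = i , u≢v , ε
  escape (par g h) (inj₁ j) (inj₂ (inj₁ u)) u≢v =
    other j , (other-≢ j ∘ inj₁-injective) ,
    exit-parˡ g h (other j) (other-≢ j ∘ inj₁-injective) (λ ()) (reach-port g (λ _ ()) u (other j))
  escape (par g h) (inj₁ j) (inj₂ (inj₂ u)) u≢v =
    other j , (other-≢ j ∘ inj₁-injective) ,
    exit-parʳ g h (other j) (other-≢ j ∘ inj₁-injective) (λ ()) (reach-port h (λ _ ()) u (other j))
  escape (par g h) (inj₂ (inj₁ v)) (inj₂ (inj₂ u)) u≢v =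
    zero , (λ ()) , exit-parʳ g h zero (λ ()) (λ ()) (reach-port h (λ _ ()) u zero)
  escape (par g h) (inj₂ (inj₂ v)) (inj₂ (inj₁ u)) u≢v =
    zero , (λ ()) , exit-parˡ g h zero (λ ()) (λ ()) (reach-port g (λ _ ()) u zero)
  escape (par g h) (inj₂ (inj₁ v)) (inj₂ (inj₁ u)) u≢v
    with i , p≢v , path ← escape g v u (u≢v ∘ cong (inj₂ ∘ inj₁)) =
    i , (λ ()) , exit-parˡ g h i (λ ()) (p≢v ∘ inj₁-injective ∘ inj₂-injective)
      (gmap id (λ (a , x , y) → a , x ∘ inj₁-injective ∘ inj₂-injective , y ∘ inj₁-injective ∘ inj₂-injective) path)
  escape (par g h) (inj₂ (inj₂ v)) (inj₂ (inj₂ u)) u≢v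
    with i , p≢v , path ← escape h v u (u≢v ∘ cong (inj₂ ∘ inj₂)) =
    i , (λ ()) , exit-parʳ g h i (λ ()) (p≢v ∘ inj₂-injective ∘ inj₂-injective)
      (gmap id (λ (a , x , y) → a , x ∘ inj₂-injective ∘ inj₂-injective , y ∘ inj₂-injective ∘ inj₂-injective) path)

  nonempty : ∀ g → 1 ≤ size (vertices g)
  nonempty k33        = s≤s z≤n
  nonempty (bridge g) = s≤s z≤n
  nonempty (par g h)  = s≤s z≤n

  -- The closed graph: simple, bipartite, cubic, 2-connected.

  -- The theta graph: the two hubs of par g h, left with one free half-edge each, are joined.
  module Theta (g h : Gadget) where

    code : Code
    code = vertices (par g h)

    link : El code → El code → Bool
    link (inj₁ i) (inj₁ j) = not (eq (leaf 2) i j)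
    link (inj₁ i) (inj₂ w) = adj (par g h) (inj₁ i) (inj₂ w)
    link (inj₂ u) w        = adj (par g h) (inj₂ u) w

    link-sym : ∀ u w → link u w ≡ link w u
    link-sym (inj₁ zero)       (inj₁ zero)       = refl
    link-sym (inj₁ zero)       (inj₁ (suc zero)) = refl
    link-sym (inj₁ (suc zero)) (inj₁ zero)       = refl
    link-sym (inj₁ (suc zero)) (inj₁ (suc zero)) = refl
    link-sym (inj₁ i) (inj₂ w) = adj-sym (par g h) (inj₁ i) (inj₂ w)
    link-sym (inj₂ u) (inj₁ j) = adj-sym (par g h) (inj₂ u) (inj₁ j)
    link-sym (inj₂ u) (inj₂ w) = adj-sym (par g h) (inj₂ u) (inj₂ w)

    adj⇒link : ∀ u w → adj (par g h) u w ≡ true → link u w ≡ true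
    adj⇒link (inj₁ i) (inj₂ w) a = a
    adj⇒link (inj₂ u) w        a = a

    color-link : ∀ u w → link u w ≡ true → color (par g h) u ≢ color (par g h) w
    color-link (inj₁ zero)       (inj₁ (suc zero)) a ()
    color-link (inj₁ (suc zero)) (inj₁ zero)       a ()
    color-link (inj₁ (suc zero)) (inj₁ (suc zero)) ()
    color-link (inj₁ i) (inj₂ w) a eq = not-¬ eq (color-adj (par g h) (inj₁ i) (inj₂ w) a)
    color-link (inj₂ u) w        a eq = not-¬ eq (color-adj (par g h) (inj₂ u) w a)

    -- A loop would join a vertex to one of its own colour.
    link-irrefl : ∀ v → link v v ≡ false
    link-irrefl v = ¬-not (λ a → color-link v v a refl)

    graph : SimpleGraph
    graph = record
      { n      = size code
      ; Adj    = λ u w → link (to code u) (to code w)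
      ; sym    = λ u w → link-sym (to code u) (to code w)
      ; irrefl = λ v → link-irrefl (to code v)
      }

    bipartite : Bipartite graph
    bipartite = color (par g h) ∘ to code , λ u w → color-link (to code u) (to code w)

    link-degree : ∀ u → ∑ code (λ w → ⟦ link u w ⟧) ≡ 3
    link-degree (inj₁ zero)
      rewrite ∑-eq (vertices g) (port g zero) | ∑-eq (vertices h) (port h zero) = refl
    link-degree (inj₁ (suc zero))
      rewrite ∑-eq (vertices g) (port g (suc zero)) | ∑-eq (vertices h) (port h (suc zero)) = refl
    link-degree (inj₂ u) = trans (≡-sym (+-identityʳ _)) (deg-portal (par g h) (inj₂ u))

    cubic : Cubic graph
    cubic v = trans (sum-allFin code (λ w → ⟦ link (to code v) w ⟧)) (link-degree (to code v))

    Route : (El code → Set) → El code → El code → Set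
    Route P = Star (Link link P)

    toRoute : ∀ {P u w} → Path (par g h) P u w → Route P u w
    toRoute = gmap id (λ {u} {w} (a , pu , pw) → adj⇒link u w a , pu , pw)

    reverseRoute : ∀ {P u w} → Route P u w → Route P w u
    reverseRoute = reverse (λ {u} {w} (a , pu , pw) → trans (link-sym w u) a , pw , pu)

    port-route : ∀ {P} i j → P (inj₁ i) → P (inj₁ j) → Route P (inj₁ i) (inj₁ j)
    port-route zero       zero       pi pj = ε
    port-route zero       (suc zero) pi pj = (refl , pi , pj) ◅ ε
    port-route (suc zero) zero       pi pj = (refl , pi , pj) ◅ ε
    port-route (suc zero) (suc zero) pi pj = ε

    -- Both vertices escape to surviving hubs, and the hubs are adjacent.
    route-avoiding : ∀ v u w → u ≢ v → w ≢ v → Route (_≢ v) u w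
    route-avoiding v u w u≢v w≢v
      with i , i≢v , path ← escape (par g h) v u u≢v
         | j , j≢v , path′ ← escape (par g h) v w w≢v =
      toRoute path ◅◅ port-route i j i≢v j≢v ◅◅ reverseRoute (toRoute path′)

    walk : ∀ {P u w} → Route P u w → Walk graph (from code u) (from code w)
    walk ε = here
    walk (_◅_ {u} {w} (a , _) r) =
      step (subst₂ (λ x y → link x y ≡ true) (≡-sym (to-from code u)) (≡-sym (to-from code w)) a) (walk r)

    walk-avoids : ∀ {v u w} → u ≢ to code v → (r : Route (_≢ to code v) u w) → ¬ Visits v (walk r)
    walk-avoids {u = u} u≢v ε at-here = u≢v (≡-sym (to-from code u))
    walk-avoids {u = u} u≢v (_ ◅ r) (at-step _ _) = u≢v (≡-sym (to-from code u))
    walk-avoids u≢v ((_ , _ , w≢v) ◅ r) (later _ visits) = walk-avoids w≢v r visits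

    connected : Connected graph
    connected x y = subst₂ (Walk graph) (from-to code x) (from-to code y)
      (walk (toRoute (reach (to code x)) ◅◅ reverseRoute (toRoute (reach (to code y)))))
      where
      reach : ∀ u → Path (par g h) (const ⊤) u (inj₁ zero)
      reach u = reach-port (par g h) (const tt) u zero

    connected-without : ∀ v → ConnectedWithout graph v
    connected-without v x y x≢v y≢v =
      subst₂ (λ a b → Σ (Walk graph a b) λ p → ¬ Visits v p) (from-to code x) (from-to code y)
        (walk r , walk-avoids (x≢v ∘ to-injective) r)
      where
      to-injective : ∀ {a b} → to code a ≡ to code b → a ≡ b
      to-injective {a} {b} p = trans (≡-sym (from-to code a)) (trans (cong (from code) p) (from-to code b))
      r : Route (_≢ to code v) (to code x) (to code y)
      r = route-avoiding (to code v) (to code x) (to code y) (x≢v ∘ to-injective) (y≢v ∘ to-injective)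

    two-connected : TwoConnected graph
    two-connected = +-monoʳ-≤ 2 (≤-trans (nonempty g) (m≤m+n _ _)) , connected , connected-without

    -- Tours as edge multiplicities.

    links : Code
    links = leaf 1 ⊕ inner (par g h)

    link-crosses : (El code → Bool) → El links → Bool
    link-crosses S (inj₁ _) = S (inj₁ zero) xor S (inj₁ (suc zero))
    link-crosses S (inj₂ e) = crosses (par g h) S (const false) (inj₂ e)

    link-edge : ∀ u w → link u w ≡ true → ∃ λ e → ∀ S → link-crosses S e ≡ S u xor S w
    link-edge (inj₁ zero)       (inj₁ (suc zero)) a = inj₁ zero , λ S → refl
    link-edge (inj₁ (suc zero)) (inj₁ zero)       a = inj₁ zero , λ S → xor-comm (S (inj₁ zero)) _
    link-edge (inj₁ (suc zero)) (inj₁ (suc zero)) ()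
    link-edge (inj₁ i) (inj₂ w) a with e , c ← edge (par g h) (inj₁ i) (inj₂ w) a =
      inj₂ e , λ S → c S (const false)
    link-edge (inj₂ u) w        a with e , c ← edge (par g h) (inj₂ u) w a =
      inj₂ e , λ S → c S (const false)

    -- Each step is charged to the undirected edge chosen by `link-edge`, so both directions of
    -- traversal add to the same multiplicity.
    uses : ∀ {u w} → Walk graph u w → El links → ℕ
    uses here e = 0
    uses (step {u} {w} a p) e = ⟦ eq links (proj₁ (link-edge (to code u) (to code w) a)) e ⟧ + uses p e

    ∑-uses : ∀ {u w} (p : Walk graph u w) → ∑ links (uses p) ≡ len p
    ∑-uses here = ∑-zero links
    ∑-uses (step {u} {w} a p) = trans (∑-+ links (λ e → ⟦ eq links e₀ e ⟧) (uses p))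
      (cong₂ _+_ (∑-eq links e₀) (∑-uses p))
      where e₀ = proj₁ (link-edge (to code u) (to code w) a)

    link-cut : (El code → Bool) → (El links → ℕ) → ℕ
    link-cut S m = ∑ links (λ e → link-crosses S e ⊙ m e)

    link-cut-step : ∀ S {u w v} (a : link (to code u) (to code w) ≡ true) (p : Walk graph w v) →
      link-cut S (uses (step {u = u} a p)) ≡ ⟦ S (to code u) xor S (to code w) ⟧ + link-cut S (uses p)
    link-cut-step S {u} {w} a p with e , c ← link-edge (to code u) (to code w) a = begin
      ∑ links (λ e′ → link-crosses S e′ ⊙ (⟦ eq links e e′ ⟧ + uses p e′))
        ≡⟨ ∑-cong links (λ e′ → ⊙-step (link-crosses S e′) (eq links e e′) (uses p e′)) ⟩
      ∑ links (λ e′ → ⟦ eq links e e′ ⟧ * ⟦ link-crosses S e′ ⟧ + link-crosses S e′ ⊙ uses p e′)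
        ≡⟨ ∑-+ links (λ e′ → ⟦ eq links e e′ ⟧ * ⟦ link-crosses S e′ ⟧) (λ e′ → link-crosses S e′ ⊙ uses p e′) ⟩
      ∑ links (λ e′ → ⟦ eq links e e′ ⟧ * ⟦ link-crosses S e′ ⟧) + link-cut S (uses p)
        ≡⟨ cong (_+ link-cut S (uses p)) (∑-select links e (⟦_⟧ ∘ link-crosses S)) ⟩
      ⟦ link-crosses S e ⟧ + link-cut S (uses p)
        ≡⟨ cong (λ b → ⟦ b ⟧ + link-cut S (uses p)) (c S) ⟩
      ⟦ S (to code u) xor S (to code w) ⟧ + link-cut S (uses p) ∎
      where
      open ≡-Reasoning
      ⊙-step : ∀ b c n → b ⊙ (⟦ c ⟧ + n) ≡ ⟦ c ⟧ * ⟦ b ⟧ + b ⊙ n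
      ⊙-step false c n rewrite *-zeroʳ ⟦ c ⟧ = refl
      ⊙-step true  c n rewrite *-identityʳ ⟦ c ⟧ = refl

    link-cut-here : ∀ S {v} → link-cut S (uses (here {v = v})) ≡ 0
    link-cut-here S = trans (∑-cong links (λ e → ⊙-zero (link-crosses S e))) (∑-zero links)
      where
      ⊙-zero : ∀ b → b ⊙ 0 ≡ 0
      ⊙-zero false = refl
      ⊙-zero true  = refl

    -- Every step contributes the xor of the sides of its ends, and these telescope modulo 2. A
    -- closed walk thus crosses every cut an even number of times.
    link-cut-parity : ∀ S {u v} (p : Walk graph u v) →
      parity (link-cut S (uses p)) ≡ parity ⟦ S (to code u) xor S (to code v) ⟧
    link-cut-parity S {v = v} here = trans (cong parity (link-cut-here S {v}))
      (cong (parity ∘ ⟦_⟧) (≡-sym (xor-same (S (to code v)))))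
    link-cut-parity S {v = v} (step {u} {w} a p) = begin
      parity (link-cut S (uses (step {u = u} a p)))
        ≡⟨ cong parity (link-cut-step S {u} a p) ⟩
      parity (⟦ S (to code u) xor S (to code w) ⟧ + link-cut S (uses p))
        ≡⟨ parity-+ ⟦ S (to code u) xor S (to code w) ⟧ (link-cut S (uses p)) ⟩
      parity ⟦ S (to code u) xor S (to code w) ⟧ ℙ.+ parity (link-cut S (uses p))
        ≡⟨ cong (parity ⟦ S (to code u) xor S (to code w) ⟧ ℙ.+_) (link-cut-parity S p) ⟩
      parity ⟦ S (to code u) xor S (to code w) ⟧ ℙ.+ parity ⟦ S (to code w) xor S (to code v) ⟧
        ≡⟨ xor-parity (S (to code u)) (S (to code w)) (S (to code v)) ⟩
      parity ⟦ S (to code u) xor S (to code v) ⟧ ∎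
      where
      open ≡-Reasoning
      xor-parity : ∀ x y z → parity ⟦ x xor y ⟧ ℙ.+ parity ⟦ y xor z ⟧ ≡ parity ⟦ x xor z ⟧
      xor-parity false false z     = refl
      xor-parity false true  false = refl
      xor-parity false true  true  = refl
      xor-parity true  false false = refl
      xor-parity true  false true  = refl
      xor-parity true  true  false = refl
      xor-parity true  true  true  = refl

    uncrossed-start : ∀ S {u v} (p : Walk graph u v) → link-cut S (uses p) ≡ 0 → S (to code u) ≡ S (to code v)
    uncrossed-start S here _ = refl
    uncrossed-start S (step {u} {w} a p) zero-cut = trans
      (xor-zero (S (to code u)) (S (to code w)) (m+n≡0⇒m≡0 _ split))
      (uncrossed-start S p (m+n≡0⇒n≡0 ⟦ S (to code u) xor S (to code w) ⟧ split))
      where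
      split : ⟦ S (to code u) xor S (to code w) ⟧ + link-cut S (uses p) ≡ 0
      split = trans (≡-sym (link-cut-step S {u} a p)) zero-cut
      xor-zero : ∀ x y → ⟦ x xor y ⟧ ≡ 0 → x ≡ y
      xor-zero false false _ = refl
      xor-zero true  true  _ = refl

    uncrossed : ∀ S {x u v} (p : Walk graph u v) → Visits x p → link-cut S (uses p) ≡ 0 →
      S (to code x) ≡ S (to code v)
    uncrossed S here at-here _ = refl
    uncrossed S p@(step _ _) (at-step _ _) zero-cut = uncrossed-start S p zero-cut
    uncrossed S (step {u} {w} a p) (later _ visits) zero-cut = uncrossed S p visits
      (m+n≡0⇒n≡0 ⟦ S (to code u) xor S (to code w) ⟧ (trans (≡-sym (link-cut-step S {u} a p)) zero-cut))

    -- The walk is closed, so the count is even. If it were 0, all visited vertices, hence all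
    -- vertices, would lie on one side, contradicting `u` and `w`; an even nonzero count is at least
    -- 2.
    tour-balanced : (T : TSPTour graph) → ∀ S u w → S u ≡ true → S w ≡ false →
      Balanced (link-cut S (uses (TSPTour.walk T)))
    tour-balanced T S u w u∈S w∉S = even , two≤
      where
      open TSPTour T using (start; covers) renaming (walk to tour)
      even : Even (link-cut S (uses tour))
      even = trans (link-cut-parity S tour) (cong (parity ∘ ⟦_⟧) (xor-same (S (to code start))))
      side-of : link-cut S (uses tour) ≡ 0 → ∀ x → S x ≡ S (to code start)
      side-of z x = trans (cong S (≡-sym (to-from code x))) (uncrossed S tour (covers (from code x)) z)
      two≤ : 2 ≤ link-cut S (uses tour)
      two≤ with even⇒0⊎2≤ (link-cut S (uses tour)) even
      ... | inj₂ 2≤c = 2≤c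
      ... | inj₁ c≡0 = contradiction
        (trans (≡-sym u∈S) (trans (trans (side-of c≡0 u) (≡-sym (side-of c≡0 w))) w∉S)) λ ()

    -- Sets inside one part leave a hub outside, so the tour induces valid multiplicities on both
    -- parts. Either parity gives at least `B + 1` on each part, and the steps on the edge between
    -- the hubs are bounded below by 0.
    tour-length : ∀ {B} → Strong g B → Strong h B → (T : TSPTour graph) →
      2 * (B + 1) ≤ len (TSPTour.walk T)
    tour-length {B} strong₁ strong₂ T = begin
      2 * (B + 1)                                    ≡⟨ cong (B + 1 +_) (+-identityʳ (B + 1)) ⟩
      B + 1 + (B + 1)                                ≤⟨ +-mono-≤
        (least (m₁ (inj₁ zero)) (m₁ (inj₁ (suc zero))) (strong₁ m₁ valid₁))
        (least (m₂ (inj₁ zero)) (m₂ (inj₁ (suc zero))) (strong₂ m₂ valid₂)) ⟩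
      ∑ (outer g) m₁ + ∑ (outer h) m₂                ≤⟨ m≤n+m _ (m (inj₁ zero) + 0) ⟩
      ∑ links m                                      ≡⟨ ∑-uses (TSPTour.walk T) ⟩
      len (TSPTour.walk T)                           ∎
      where
      open ≤-Reasoning
      m : El links → ℕ
      m = uses (TSPTour.walk T)
      m₁ : El (outer g) → ℕ
      m₁ e = m (inj₂ (inj₁ e))
      m₂ : El (outer h) → ℕ
      m₂ e = m (inj₂ (inj₂ e))
      least : ∀ p q {F} → StrongBound B p q F → B + 1 ≤ F
      least _ _ (inj₁ (_ , _ , b)) = b
      least _ _ (inj₂ (_ , _ , b)) = ≤-trans (+-monoʳ-≤ B (n≤1+n 1)) b
      valid₁ : Valid g m₁
      valid₁ S u p = subst Balanced
        (trans (cong (cut g S (const false) m₁ +_) (cut-const h false (const false) m₂)) (+-identityʳ _))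
        (tour-balanced T [ const false , [ S , const false ]′ ]′ (inj₂ (inj₁ u)) (inj₁ zero) p refl)
      valid₂ : Valid h m₂
      valid₂ S u p = subst Balanced
        (cong (_+ cut h S (const false) m₂) (cut-const g false (const false) m₁))
        (tour-balanced T [ const false , [ const false , S ]′ ]′ (inj₂ (inj₂ u)) (inj₁ zero) p refl)

  -- The iterated gadgets and their sizes.

  tower : ℕ → Gadget
  tower zero    = k33
  tower (suc k) = bridge (par (tower k) (tower k))

  -- Vertex count plus forced excess of tower k, by the recursion of par-weak and bridge-strong.
  tower-bound : ℕ → ℕ
  tower-bound zero    = 6
  tower-bound (suc k) = 2 * tower-bound k + 4 + 2

  tower-strong : ∀ k → Strong (tower k) (tower-bound k)
  tower-strong zero    = k33-strong
  tower-strong (suc k) = bridge-strong (par (tower k) (tower k))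
    (par-weak (tower k) (tower k) (tower-strong k) (tower-strong k))

  -- Both sides start at 36 and obey the same recursion, doubling and adding 24.
  tower-bound-size : ∀ k → 5 * tower-bound k + 6 ≡ 6 * size (vertices (tower k))
  tower-bound-size zero    = refl
  tower-bound-size (suc k) = begin
    5 * (2 * B + 4 + 2) + 6  ≡⟨ lem₁ B ⟩
    2 * (5 * B + 6) + 24     ≡⟨ cong (λ x → 2 * x + 24) (tower-bound-size k) ⟩
    2 * (6 * s) + 24         ≡⟨ lem₂ s ⟩
    6 * (2 + (2 + (s + s)))  ∎
    where
    open ≡-Reasoning
    B s : ℕ
    B = tower-bound k
    s = size (vertices (tower k))
    lem₁ : ∀ B → 5 * (2 * B + 4 + 2) + 6 ≡ 2 * (5 * B + 6) + 24
    lem₁ = solve-∀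
    lem₂ : ∀ s → 2 * (6 * s) + 24 ≡ 6 * (2 + (2 + (s + s)))
    lem₂ = solve-∀

  size-grows : ∀ k → k ≤ size (vertices (tower k))
  size-grows zero    = z≤n
  size-grows (suc k) = s≤s (≤-trans (size-grows k) (≤-trans (m≤m+n s s) (m≤n+m (s + s) 3)))
    where s = size (vertices (tower k))

  -- Passage from the integer bound to the rational ratio.

  open import Data.Integer as ℤ using (ℤ; +_)
  import Data.Integer.Properties as ℤ
  import Data.Integer.Tactic.RingSolver as ℤ-Solver
  open import Data.Rational as ℚ using (ℚ; mkℚ; toℚᵘ; Positive)
  import Data.Rational.Properties as ℚ
  open import Data.Rational.Unnormalised as ℚᵘ using (ℚᵘ; mkℚᵘ)
  import Data.Rational.Unnormalised.Properties as ℚᵘ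

  -- With the given rational equal to `suc a / d`, this is the desired ratio multiplied by `5 * d`,
  -- with the negative term moved across. The deficit `14 * d` is absorbed by `5 * n`, and the
  -- numerator `suc a` is at least 1.
  numerators : ∀ d a n l → 14 * d ≤ 5 * n → 6 * n ≤ 5 * l + 14 →
    6 * d * n ≤ 5 * d * l + suc a * 5 * n
  numerators d a n l large short = begin
    6 * d * n                    ≡⟨ solve (d ∷ n ∷ []) ⟩
    d * (6 * n)                  ≤⟨ *-monoʳ-≤ d short ⟩
    d * (5 * l + 14)             ≡⟨ solve (d ∷ l ∷ []) ⟩
    5 * d * l + 14 * d           ≤⟨ +-monoʳ-≤ (5 * d * l) large ⟩
    5 * d * l + 5 * n            ≤⟨ +-monoʳ-≤ (5 * d * l) (*-monoˡ-≤ n (m≤m+n 5 (a * 5))) ⟩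
    5 * d * l + suc a * 5 * n    ∎
    where open ≤-Reasoning

  -- The shape, including the factors 1, is what the order on unnormalised rationals unfolds to by
  -- cross multiplication in `below`.
  cleared : ∀ d a n l → 14 * d ≤ 5 * n → 6 * n ≤ 5 * l + 14 →
    (+ 6 ℤ.* + d ℤ.+ ℤ.- (+ suc a) ℤ.* + 5) ℤ.* + n ℤ.* + 1 ℤ.≤ + l ℤ.* + (5 * d * 1)
  cleared d a n l large short = begin
    (+ 6 ℤ.* + d ℤ.+ ℤ.- (+ suc a) ℤ.* + 5) ℤ.* + n ℤ.* + 1
      ≡⟨ expand (+ d) (+ suc a) (+ n) ⟩
    + 6 ℤ.* + d ℤ.* + n ℤ.- + suc a ℤ.* + 5 ℤ.* + n
      ≡⟨ cong₂ ℤ._-_ (pos-*³ 6 d n) (pos-*³ (suc a) 5 n) ⟩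
    + (6 * d * n) ℤ.- + (suc a * 5 * n)
      ≤⟨ ℤ.+-monoˡ-≤ (ℤ.- + (suc a * 5 * n)) (ℤ.+≤+ (numerators d a n l large short)) ⟩
    + (5 * d * l + suc a * 5 * n) ℤ.- + (suc a * 5 * n)
      ≡⟨ cancel (+ (5 * d * l)) (+ (suc a * 5 * n)) ⟩
    + (5 * d * l)
      ≡⟨ cong +_ (reorder d l) ⟩
    + (l * (5 * d * 1))
      ≡⟨ ℤ.pos-* l (5 * d * 1) ⟩
    + l ℤ.* + (5 * d * 1) ∎
    where
    open ℤ.≤-Reasoning
    expand : ∀ x y z → (+ 6 ℤ.* x ℤ.+ ℤ.- y ℤ.* + 5) ℤ.* z ℤ.* + 1 ≡ + 6 ℤ.* x ℤ.* z ℤ.- y ℤ.* + 5 ℤ.* z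
    expand = ℤ-Solver.solve-∀
    cancel : ∀ x y → x ℤ.+ y ℤ.- y ≡ x
    cancel = ℤ-Solver.solve-∀
    pos-*³ : ∀ x y z → + x ℤ.* + y ℤ.* + z ≡ + (x * y * z)
    pos-*³ x y z = trans (cong (ℤ._* + z) (≡-sym (ℤ.pos-* x y))) (≡-sym (ℤ.pos-* (x * y) z))
    reorder : ∀ d l → 5 * d * l ≡ l * (5 * d * 1)
    reorder = solve-∀

  below : ∀ r → Positive r → ∀ n l → 14 * ℚ.↧ₙ r ≤ 5 * n → 6 * n ≤ 5 * l + 14 →
    ((+ 6 ℚ./ 5) ℚ.- r) ℚ.* (+ n ℚ./ 1) ℚ.≤ (+ l ℚ./ 1)
  below r@(mkℚ (+ suc a) d-1 _) _ n l large short = ℚ.toℚᵘ-cancel-≤ (begin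
    toℚᵘ (((+ 6 ℚ./ 5) ℚ.- r) ℚ.* (+ n ℚ./ 1))
      ≃⟨ ℚ.toℚᵘ-homo-* ((+ 6 ℚ./ 5) ℚ.- r) (+ n ℚ./ 1) ⟩
    toℚᵘ ((+ 6 ℚ./ 5) ℚ.- r) ℚᵘ.* toℚᵘ (+ n ℚ./ 1)
      ≃⟨ ℚᵘ.*-cong (ℚᵘ.≃-trans (ℚ.toℚᵘ-homo-+ (+ 6 ℚ./ 5) (ℚ.- r))
                     (ℚᵘ.+-congʳ (toℚᵘ (+ 6 ℚ./ 5)) (ℚ.toℚᵘ-homo‿- r)))
                   (ℚ.toℚᵘ-fromℚᵘ (mkℚᵘ (+ n) 0)) ⟩
    (mkℚᵘ (+ 6) 4 ℚᵘ.- toℚᵘ r) ℚᵘ.* mkℚᵘ (+ n) 0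
      ≤⟨ ℚᵘ.*≤* (cleared (suc d-1) a n l large short) ⟩
    mkℚᵘ (+ l) 0
      ≃⟨ ℚ.toℚᵘ-fromℚᵘ (mkℚᵘ (+ l) 0) ⟨
    toℚᵘ (+ l ℚ./ 1) ∎)
    where open ℚᵘ.≤-Reasoning

  tour-bound : ∀ k (T : TSPTour (Theta.graph (tower k) (tower k))) →
    6 * order (Theta.graph (tower k) (tower k)) ≤ 5 * len (TSPTour.walk T) + 14
  tour-bound k T = begin
    6 * (2 + (s + s))                ≡⟨ lem₁ s ⟩
    2 * (6 * s) + 12                 ≡⟨ cong (λ x → 2 * x + 12) (tower-bound-size k) ⟨
    2 * (5 * B + 6) + 12             ≡⟨ lem₂ B ⟩
    5 * (2 * (B + 1)) + 14           ≤⟨ +-monoˡ-≤ 14 (*-monoʳ-≤ 5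
                                          (Theta.tour-length (tower k) (tower k) (tower-strong k) (tower-strong k) T)) ⟩
    5 * len (TSPTour.walk T) + 14    ∎
    where
    open ≤-Reasoning
    B s : ℕ
    B = tower-bound k
    s = size (vertices (tower k))
    lem₁ : ∀ s → 6 * (2 + (s + s)) ≡ 2 * (6 * s) + 12
    lem₁ = solve-∀
    lem₂ : ∀ B → 2 * (5 * B + 6) + 12 ≡ 5 * (2 * (B + 1)) + 14
    lem₂ = solve-∀


  order-grows : ∀ k → k ≤ order (Theta.graph (tower k) (tower k))
  order-grows k = ≤-trans (size-grows k) (≤-trans (m≤m+n s s) (m≤n+m (s + s) 2))
    where s = size (vertices (tower k))

  tour-ratio : ∀ r → Positive r → let k = 14 * ℚ.↧ₙ r; G = Theta.graph (tower k) (tower k) in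
    ∀ (T : TSPTour G) →
    ((+ 6 ℚ./ 5) ℚ.- r) ℚ.* (+ order G ℚ./ 1) ℚ.≤ (+ len (TSPTour.walk T) ℚ./ 1)
  tour-ratio r pos T = below r pos (order G) (len (TSPTour.walk T))
    -- The height `14 * ↧ₙ r` is chosen so that the order is at least 14 times the denominator of
    -- `r`, as `numerators` requires.
    (≤-trans (order-grows k) (m≤n*m (order G) 5)) (tour-bound k T)
    where
    k : ℕ
    k = 14 * ℚ.↧ₙ r
    G : SimpleGraph
    G = Theta.graph (tower k) (tower k)

open import Data.Rational using (ℚ; Positive; _-_; _≤_; _*_; _/_; ↧ₙ_)
import Data.Nat as ℕ
open import Data.Integer using (+_)
open import Data.Product using (Σ; _×_; _,_)

theorem2 : ∀ (ε : ℚ) → Positive ε →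
    Σ SimpleGraph λ G → TwoConnected G × Bipartite G × Cubic G ×
    (∀ (T : TSPTour G) →
    ((+ 6 / 5) - ε) * (+ order G / 1) ≤ (+ len (TSPTour.walk T) / 1))
theorem2 ε pos = graph , two-connected , bipartite , cubic , tour-ratio ε pos
  where open Theta (tower (14 ℕ.* ↧ₙ ε)) (tower (14 ℕ.* ↧ₙ ε))
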